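{- Let $M$ be a matroid on the ground set $E=[n]=\{1,\dots,n\}$ with set of circuits $\mathcal{C}$, and let $C\in\mathcal{C}$ be a circuit of $M$. Then $$\beta_C=\sum_{k=0}^{|\mathcal{C}|-1}\left((-1)^k\cdot\sum_{\substack{S\subseteq\mathcal{C}\setminus\{C\},\\ |S|=k}}\frac{|C|}{\left|\left(\bigcup_{C'\in S}C'\right)\cup C\right|}\right).$$
   Context: Matroid bingo: let $M$ be a matroid on a finite set $E$ with $|E|=n$ and circuit set $\mathcal{C}$. The elements of $E$ are called out one at a time in a uniformly random order $\sigma(1),\sigma(2),\dots,\sigma(n)$ (a uniformly random permutation of $E$). A circuit $C$ wins in round $t$ if $C\subseteq\{\sigma(1),\dots,\sigma(t)\}$ and no circuit of $M$ is contained in $\{\sigma(1),\dots,\sigma(t-1)\}$; thus the winner is the first circuit to be completed (the circuit axioms guarantee that there is no tie). $\beta_C$ denotes the probability that $C$ wins (in some round). -}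

module Defs where

open import Data.Bool.Properties as Bool using ()
open import Data.Bool.Base using (Bool; true; false)
open import Data.Fin.Base using (Fin; toℕ)
import Data.Fin.Properties as Fin
open import Data.Fin.Subset
open import Data.Fin.Subset.Properties
open import Data.Integer.Base using (+_)
open import Data.List.Base as List
  using (List; []; _∷_; _++_; length; filter; cartesianProductWith)
import Data.List.Membership.Propositional as List
open import Data.List.Membership.Propositional.Properties
  using (∈-filter⁺; ∈-cartesianProductWith⁺; ∈-allFin)
open import Data.List.Relation.Unary.Any using (here)
open import Data.Nat.Base as ℕ using (ℕ; zero; suc; NonZero; >-nonZero; z<s)
import Data.Nat.Properties as ℕ
open import Data.Product.Base using (∃; _×_; _,_)
open import Data.Rational.Base using (ℚ; 0ℚ; _+_; _/_)
open import Data.Vec.Base as Vec using (Vec; []; _∷_)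
import Data.Vec.Properties as Vec
open import Data.Vec.Relation.Unary.Unique.Propositional using (Unique)
import Data.Vec.Relation.Unary.Unique.Propositional.Properties as Unique
open import Data.Vec.Relation.Unary.AllPairs using (allPairs?)
open import Function.Base using (id)
open import Level using (0ℓ)
open import Relation.Binary.Definitions using (DecidableEquality)
open import Relation.Binary.PropositionalEquality
open import Relation.Nullary using (¬_; contradiction)
open import Relation.Nullary.Decidable using (¬?; _×-dec_)
open import Relation.Unary using (Pred; Decidable)

private
  variable
    A : Set
    n : ℕ

∑ : List A → (A → ℚ) → ℚ
∑ xs f = List.foldr _+_ 0ℚ (List.map f xs)

infix 5 ∑
syntax ∑ xs (λ x → e) = ∑[ x ∈ xs ] e

-- All words of length k over the letters xs.
words : List A → ∀ k → List (Vec A k)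
words xs zero    = [] ∷ []
words xs (suc k) = cartesianProductWith _∷_ xs (words xs k)

-- For a duplicate-free xs, these represent each subset of xs exactly once.
sublists : List A → List (List A)
sublists []       = [] ∷ []
sublists (x ∷ xs) = List.map (x ∷_) (sublists xs) ++ sublists xs

sublistsOfSize : ℕ → List A → List (List A)
sublistsOfSize k xs = filter (λ ys → length ys ℕ.≟ k) (sublists xs)

-- The probability of P under the uniform distribution on a non-empty,
-- duplicate-free list Ω of outcomes.
Pr : (Ω : List A) .{{_ : NonZero (length Ω)}} {P : Pred A 0ℓ} → Decidable P → ℚ
Pr Ω P? = + length (filter P? Ω) / length Ω

_≟ˢ_ : DecidableEquality (Subset n)
_≟ˢ_ = Vec.≡-dec Bool._≟_

-- Matroids on the ground set Fin n, given by the circuit axioms.  As the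
-- ground set is finite, classically every set of circuits is decidable.
record Matroid (n : ℕ) : Set₁ where
  field
    Circuit      : Pred (Subset n) 0ℓ
    circuit?     : Decidable Circuit
    ⊥-notCircuit : ¬ Circuit ⊥
    minimal      : ∀ {C D} → Circuit C → Circuit D → C ⊆ D → C ≡ D
    elimination  : ∀ {C D e} → Circuit C → Circuit D → C ≢ D → e ∈ C ∩ D →
                   ∃ λ F → Circuit F × F ⊆ (C ∪ D) - e

open Matroid public

-- The circuit set, each circuit listed exactly once.
circuits : Matroid n → List (Subset n)
circuits {n} M = filter (circuit? M) (words (true ∷ false ∷ []) n)

_∖_ : List (Subset n) → Subset n → List (Subset n)
𝒞 ∖ C = filter (λ D → ¬? (D ≟ˢ C)) 𝒞

unique? : ∀ {k} → Decidable (Unique {A = Fin n} {n = k})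
unique? = allPairs? (λ i j → ¬? (i Fin.≟ j))

-- An injective word of length n over Fin n is a permutation σ of the ground
-- set, with letters σ(1), …, σ(n).
orders : ∀ n → List (Vec (Fin n) n)
orders n = filter unique? (words (List.allFin n) n)

-- {σ(1), …, σ(t)}
called : Vec (Fin n) n → ℕ → Subset n
called σ t = ⋃ (List.map ⁅_⁆ (List.take t (Vec.toList σ)))

ContainsCircuit : Matroid n → Pred (Subset n) 0ℓ
ContainsCircuit M p = ∃ λ D → Circuit M D × D ⊆ p

-- The rounds 1, …, n are represented as suc (toℕ i) for i : Fin n.
WinsInRound : Matroid n → Subset n → Vec (Fin n) n → Fin n → Set
WinsInRound M C σ i =
  C ⊆ called σ (suc (toℕ i)) × ¬ ContainsCircuit M (called σ (toℕ i))

Wins : Matroid n → Subset n → Pred (Vec (Fin n) n) 0ℓ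
Wins M C σ = ∃ λ i → WinsInRound M C σ i

containsCircuit? : (M : Matroid n) → Decidable (ContainsCircuit M)
containsCircuit? M p = anySubset? (λ D → circuit? M D ×-dec D ⊆? p)

wins? : (M : Matroid n) (C : Subset n) → Decidable (Wins M C)
wins? M C σ = Fin.any? λ i →
  C ⊆? called σ (suc (toℕ i)) ×-dec ¬? (containsCircuit? M (called σ (toℕ i)))

∈-words : ∀ {xs : List A} → (∀ x → x List.∈ xs) →
          ∀ {k} (w : Vec A k) → w List.∈ words xs k
∈-words all []      = here refl
∈-words all (x ∷ w) = ∈-cartesianProductWith⁺ _∷_ (all x) (∈-words all w)

orders-nonZero : ∀ n → NonZero (length (orders n))
orders-nonZero n = nonEmpty (∈-filter⁺ unique?
  (∈-words ∈-allFin (Vec.allFin n)) (Unique.tabulate⁺ id))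
  where
  nonEmpty : ∀ {x : A} {xs} → x List.∈ xs → NonZero (length xs)
  nonEmpty {xs = _ ∷ _} _ = _

β : Matroid n → Subset n → ℚ
β {n} M C = Pr (orders n) {{orders-nonZero n}} (wins? M C)

circuit-nonZero : (M : Matroid n) {C : Subset n} → Circuit M C → NonZero ∣ C ∣
circuit-nonZero M {C} isC with ∣ C ∣ in eq
... | suc _ = _
... | zero  = contradiction (subst (Circuit M) (∣p∣≡0⇒p≡⊥ C eq) isC) (⊥-notCircuit M)
  where
  ∣p∣≡0⇒p≡⊥ : ∀ {m} (p : Subset m) → ∣ p ∣ ≡ 0 → p ≡ ⊥
  ∣p∣≡0⇒p≡⊥ []          _  = refl
  ∣p∣≡0⇒p≡⊥ (false ∷ p) eq = cong (false ∷_) (∣p∣≡0⇒p≡⊥ p eq)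

∪-circuit-nonZero : (M : Matroid n) {C : Subset n} → Circuit M C →
                    ∀ p → NonZero ∣ p ∪ C ∣
∪-circuit-nonZero M {C} isC p = >-nonZero
  (ℕ.<-≤-trans (ℕ.>-nonZero⁻¹ ∣ C ∣ {{circuit-nonZero M isC}}) (∣q∣≤∣p∪q∣ p C))

{-# OPTIONS --safe #-}

-- Let t be the round that completes C.  By circuit elimination, C wins exactly
-- if no other circuit is complete after round t.  Apply inclusion–exclusion to
-- the events "D is complete after round t".  All D ∈ S are complete after round t
-- exactly if the last called element of U = ⋃ S ∪ C lies in C; permuting the
-- labels within U shows that this has probability |C| / |U|.

module Submission where

open import Defs
open import Data.Fin.Subset using (Subset; ∣_∣; _∪_; ⋃)
open import Data.Integer.Base using (+_)
open import Data.List.Base using (length; upTo)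
open import Data.Nat.Base using (ℕ)
open import Data.Rational.Base using (1ℚ; -_; _*_; _/_; +-*-rawSemiring)
open import Algebra.Definitions.RawSemiring +-*-rawSemiring using (_^_)
open import Relation.Binary.PropositionalEquality using (_≡_)

import Data.Bool.Base as Bool
open import Data.Fin.Base as Fin using (Fin; zero; suc; toℕ; punchOut)
import Data.Fin.Permutation.Components as Perm
import Data.Fin.Properties as Fin
open import Data.Fin.Subset as Subset using (_∈_; _∉_; _⊆_; ⁅_⁆; inside; outside)
open import Data.Fin.Subset.Properties as Subset using (_∈?_; _⊆?_; x∈⁅x⁆; x∈⁅y⁆⇒x≡y)
import Data.Integer.Base as ℤ
import Data.Integer.Properties as ℤ
open import Data.List.Base as List using (List; []; _∷_; _++_; filter; allFin)
open import Data.List.Membership.Propositional as List using (find; lose)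
import Data.List.Membership.Propositional.Properties as List
open import Data.List.Membership.Propositional.Properties.WithK using (unique∧set⇒bag)
import Data.List.Properties as List
open import Data.List.Relation.Binary.BagAndSetEquality using (∼bag⇒↭)
open import Data.List.Relation.Binary.Permutation.Propositional using (_↭_; ↭⇒↭ₛ)
import Data.List.Relation.Binary.Permutation.Propositional.Properties as ↭
import Data.List.Relation.Binary.Permutation.Setoid.Properties as ↭ₛ
open import Data.List.Relation.Unary.All as All using (All; []; _∷_)
open import Data.List.Relation.Unary.AllPairs using ([]; _∷_)
open import Data.List.Relation.Unary.Any as Any using (Any; here; there)
import Data.List.Relation.Unary.Unique.Propositional as List
import Data.List.Relation.Unary.Unique.Propositional.Properties as Unique
open import Data.Nat.Base as ℕ using (zero; suc; NonZero; s≤s; z<s; s<s)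
import Data.Nat.Properties as ℕ
open import Data.Product.Base using (∃; _×_; _,_; proj₁; proj₂)
open import Data.Rational.Base using (ℚ; 0ℚ; _+_; toℚᵘ)
open import Data.Rational.Properties
import Data.Rational.Unnormalised.Base as ℚᵘ
import Data.Rational.Unnormalised.Properties as ℚᵘ
open import Data.Rational.Solver using (module +-*-Solver)
open import Data.Sum.Base using (inj₁; inj₂; [_,_]′)
open import Data.Vec.Base as Vec using (Vec; []; _∷_; lookup)
import Data.Vec.Properties as Vec
open import Data.Vec.Relation.Unary.Unique.Propositional using () renaming (Unique to Injective)
import Data.Vec.Relation.Unary.Unique.Propositional.Properties as Vec
open import Function.Base using (_∘_; id)
open import Function.Bundles using (_⇔_; mk⇔; module Equivalence)
open import Level using (Level)
open import Relation.Binary.Definitions using (DecidableEquality)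
open import Relation.Binary.PropositionalEquality
  using (_≢_; refl; sym; trans; cong; cong₂; subst; setoid; module ≡-Reasoning)
open import Relation.Nullary using (¬_; Dec; yes; no; does; contradiction)
open import Relation.Nullary.Decidable
  using (¬?; _×-dec_; _→-dec_; dec-true; dec-false; does-⇔)
open import Relation.Unary using (Pred; Decidable)

open Equivalence using (to; from)

private
  variable
    p : Level
    A B P Q : Set
    m n : ℕ

-- Finite sums over lists

∑-cong : ∀ {f g : A → ℚ} xs → (∀ {x} → x List.∈ xs → f x ≡ g x) → ∑ xs f ≡ ∑ xs g
∑-cong []       f≗g = refl
∑-cong (x ∷ xs) f≗g = cong₂ _+_ (f≗g (here refl)) (∑-cong xs (f≗g ∘ there))

∑-zero : ∀ {f : A → ℚ} xs → (∀ {x} → x List.∈ xs → f x ≡ 0ℚ) → ∑ xs f ≡ 0ℚ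
∑-zero []       f≗0 = refl
∑-zero (x ∷ xs) f≗0 = trans (cong₂ _+_ (f≗0 (here refl)) (∑-zero xs (f≗0 ∘ there))) (+-identityˡ 0ℚ)

∑-++ : ∀ (f : A → ℚ) xs ys → ∑ (xs ++ ys) f ≡ ∑ xs f + ∑ ys f
∑-++ f []       ys = sym (+-identityˡ _)
∑-++ f (x ∷ xs) ys = trans (cong (_+_ (f x)) (∑-++ f xs ys)) (sym (+-assoc (f x) _ _))

∑-map : ∀ (h : A → B) (f : B → ℚ) xs → ∑ (List.map h xs) f ≡ ∑ xs (f ∘ h)
∑-map h f []       = refl
∑-map h f (x ∷ xs) = cong (_+_ (f (h x))) (∑-map h f xs)

∑-+ : ∀ (f g : A → ℚ) xs → (∑[ x ∈ xs ] f x + g x) ≡ ∑ xs f + ∑ xs g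
∑-+ f g []       = sym (+-identityˡ 0ℚ)
∑-+ f g (x ∷ xs) = trans (cong (_+_ (f x + g x)) (∑-+ f g xs))
  (solve 4 (λ a b c d → a :+ b :+ (c :+ d) := a :+ c :+ (b :+ d)) refl (f x) (g x) (∑ xs f) (∑ xs g))
  where open +-*-Solver

∑-*ˡ : ∀ c (f : A → ℚ) xs → (∑[ x ∈ xs ] c * f x) ≡ c * ∑ xs f
∑-*ˡ c f []       = sym (*-zeroʳ c)
∑-*ˡ c f (x ∷ xs) = trans (cong (_+_ (c * f x)) (∑-*ˡ c f xs)) (sym (*-distribˡ-+ c (f x) _))

∑-*ʳ : ∀ c (f : A → ℚ) xs → (∑[ x ∈ xs ] f x * c) ≡ ∑ xs f * c
∑-*ʳ c f xs = trans (∑-cong xs (λ {x} _ → *-comm (f x) c)) (trans (∑-*ˡ c f xs) (*-comm c _))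

∑-swap : ∀ (f : A → B → ℚ) xs ys →
         (∑[ x ∈ xs ] ∑[ y ∈ ys ] f x y) ≡ (∑[ y ∈ ys ] ∑[ x ∈ xs ] f x y)
∑-swap f []       ys = sym (∑-zero ys (λ _ → refl))
∑-swap f (x ∷ xs) ys = trans (cong (_+_ (∑ ys (f x))) (∑-swap f xs ys)) (sym (∑-+ (f x) _ ys))

∑-↭ : ∀ (f : A → ℚ) {xs ys} → xs ↭ ys → ∑ xs f ≡ ∑ ys f
∑-↭ f xs↭ys = ↭ₛ.foldr-commMonoid (setoid ℚ) +-0-isCommutativeMonoid (↭⇒↭ₛ (↭.map⁺ f xs↭ys))

-- Indicators

𝟙 : Dec P → ℚ
𝟙 P? = Bool.if does P? then 1ℚ else 0ℚ

𝟙-cong : P ⇔ Q → (P? : Dec P) (Q? : Dec Q) → 𝟙 P? ≡ 𝟙 Q?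
𝟙-cong P⇔Q P? Q? = cong (Bool.if_then 1ℚ else 0ℚ) (does-⇔ P⇔Q P? Q?)

𝟙-yes : (P? : Dec P) → P → 𝟙 P? ≡ 1ℚ
𝟙-yes P? p = cong (Bool.if_then 1ℚ else 0ℚ) (dec-true P? p)

𝟙-no : (P? : Dec P) → ¬ P → 𝟙 P? ≡ 0ℚ
𝟙-no P? ¬p = cong (Bool.if_then 1ℚ else 0ℚ) (dec-false P? ¬p)

𝟙-× : (P? : Dec P) (Q? : Dec Q) → 𝟙 (P? ×-dec Q?) ≡ 𝟙 P? * 𝟙 Q?
𝟙-× P? Q? with does P?
... | Bool.true  = sym (*-identityˡ _)
... | Bool.false = sym (*-zeroˡ (𝟙 Q?))

𝟙-¬ : (P? : Dec P) → 𝟙 (¬? P?) ≡ 1ℚ + - 1ℚ * 𝟙 P?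
𝟙-¬ P? with does P?
... | Bool.true  = refl
... | Bool.false = refl

∑-filter : ∀ {P : Pred A _} (P? : Decidable P) (f : A → ℚ) xs →
           ∑ (filter P? xs) f ≡ (∑[ x ∈ xs ] 𝟙 (P? x) * f x)
∑-filter P? f [] = refl
∑-filter P? f (x ∷ xs) with does (P? x)
... | Bool.true  = cong₂ _+_ (sym (*-identityˡ (f x))) (∑-filter P? f xs)
... | Bool.false = trans (∑-filter P? f xs)
  (sym (trans (cong (_+ _) (*-zeroˡ (f x))) (+-identityˡ _)))

-- A Kronecker delta: in a duplicate-free list exactly one term survives.
∑-pick : (_≟_ : DecidableEquality A) (f : A → ℚ) {a : A} {xs : List A} →
         List.Unique xs → a List.∈ xs → (∑[ x ∈ xs ] 𝟙 (a ≟ x) * f x) ≡ f a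
∑-pick _≟_ f {a} {x ∷ xs} (x∉xs ∷ _) (here refl) = begin
  𝟙 (a ≟ a) * f a + (∑[ y ∈ xs ] 𝟙 (a ≟ y) * f y)
    ≡⟨ cong₂ _+_ (cong (_* f a) (𝟙-yes (a ≟ a) refl)) (∑-zero xs λ {y} y∈xs →
         trans (cong (_* f y) (𝟙-no (a ≟ y) (All.lookup x∉xs y∈xs))) (*-zeroˡ (f y))) ⟩
  1ℚ * f a + 0ℚ  ≡⟨ +-identityʳ _ ⟩
  1ℚ * f a       ≡⟨ *-identityˡ (f a) ⟩
  f a            ∎
  where open ≡-Reasoning
∑-pick _≟_ f {a} {x ∷ xs} (x∉xs ∷ xs!) (there a∈xs) = begin
  𝟙 (a ≟ x) * f x + (∑[ y ∈ xs ] 𝟙 (a ≟ y) * f y)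
    ≡⟨ cong₂ _+_ (cong (_* f x) (𝟙-no (a ≟ x) λ { refl → All.lookup x∉xs a∈xs refl }))
                 (∑-pick _≟_ f xs! a∈xs) ⟩
  0ℚ * f x + f a  ≡⟨ cong (_+ f a) (*-zeroˡ (f x)) ⟩
  0ℚ + f a        ≡⟨ +-identityˡ (f a) ⟩
  f a             ∎
  where open ≡-Reasoning

-- Inclusion-exclusion and sums over sublists

-- The indicator of "no `Q`" is the product of the factors `1 - 𝟙 (Q? x)`; expanding it chooses, for
-- each `x`, whether `x` belongs to `S`.
inclusion-exclusion :
  ∀ {Q : Pred A _} (Q? : Decidable Q) xs →
  𝟙 (All.all? (¬? ∘ Q?) xs) ≡ (∑[ S ∈ sublists xs ] (- 1ℚ) ^ length S * 𝟙 (All.all? Q? S))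
inclusion-exclusion Q? [] = refl
inclusion-exclusion Q? (x ∷ xs) = begin
  𝟙 (¬? (Q? x) ×-dec All.all? (¬? ∘ Q?) xs)
    ≡⟨ 𝟙-× (¬? (Q? x)) (All.all? (¬? ∘ Q?) xs) ⟩
  𝟙 (¬? (Q? x)) * 𝟙 (All.all? (¬? ∘ Q?) xs)
    ≡⟨ cong₂ _*_ (𝟙-¬ (Q? x)) (inclusion-exclusion Q? xs) ⟩
  (1ℚ + - 1ℚ * 𝟙 (Q? x)) * ∑ (sublists xs) term
    -- The two summands match the two halves of `sublists (x ∷ xs)`: with `x` and without.
    ≡⟨ solve 3 (λ s a t → (con 1ℚ :+ s :* a) :* t := (s :* a) :* t :+ t) refl
         (- 1ℚ) (𝟙 (Q? x)) (∑ (sublists xs) term) ⟩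
  (- 1ℚ * 𝟙 (Q? x)) * ∑ (sublists xs) term + ∑ (sublists xs) term
    ≡⟨ cong (_+ ∑ (sublists xs) term) (∑-*ˡ (- 1ℚ * 𝟙 (Q? x)) term (sublists xs)) ⟨
  (∑[ S ∈ sublists xs ] (- 1ℚ * 𝟙 (Q? x)) * term S) + ∑ (sublists xs) term
    ≡⟨ cong (_+ ∑ (sublists xs) term) (∑-cong (sublists xs) λ {S} _ → term-∷ S) ⟩
  (∑[ S ∈ sublists xs ] term (x ∷ S)) + ∑ (sublists xs) term
    ≡⟨ cong (_+ ∑ (sublists xs) term) (∑-map (x ∷_) term (sublists xs)) ⟨
  ∑ (List.map (x ∷_) (sublists xs)) term + ∑ (sublists xs) term
    ≡⟨ ∑-++ term (List.map (x ∷_) (sublists xs)) (sublists xs) ⟨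
  ∑ (sublists (x ∷ xs)) term ∎
  where
  open ≡-Reasoning
  open +-*-Solver
  term : List _ → ℚ
  term S = (- 1ℚ) ^ length S * 𝟙 (All.all? Q? S)

  term-∷ : ∀ S → (- 1ℚ * 𝟙 (Q? x)) * term S ≡ term (x ∷ S)
  term-∷ S = trans
    (solve 4 (λ s a t b → (s :* a) :* (t :* b) := (s :* t) :* (a :* b)) refl
      (- 1ℚ) (𝟙 (Q? x)) ((- 1ℚ) ^ length S) (𝟙 (All.all? Q? S)))
    (cong ((- 1ℚ) ^ length (x ∷ S) *_) (sym (𝟙-× (Q? x) (All.all? Q? S))))

length-sublist : ∀ (xs : List A) {S} → S List.∈ sublists xs → length S ℕ.≤ length xs
length-sublist []       (here refl) = ℕ.≤-refl
length-sublist (x ∷ xs) S∈ with List.∈-++⁻ (List.map (x ∷_) (sublists xs)) S∈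
... | inj₂ S∈xs = ℕ.m≤n⇒m≤1+n (length-sublist xs S∈xs)
... | inj₁ S∈x∷ with _ , T∈xs , refl ← List.∈-map⁻ (x ∷_) S∈x∷ = s≤s (length-sublist xs T∈xs)

-- After exchanging the sums, each `S` meets only `k = length S`, which is below `m` because a
-- sublist is no longer than `xs`. This produces the grading by `k` in the final formula.
∑-bySize : ∀ (c : ℕ → ℚ) (g : List A → ℚ) {m} xs → length xs ℕ.< m →
           (∑[ k ∈ upTo m ] c k * ∑ (sublistsOfSize k xs) g) ≡
           (∑[ S ∈ sublists xs ] c (length S) * g S)
∑-bySize c g {m} xs xs<m = begin
  (∑[ k ∈ upTo m ] c k * ∑ (sublistsOfSize k xs) g)
    ≡⟨ ∑-cong (upTo m) (λ {k} _ → cong (c k *_)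
         (∑-filter (λ S → length S ℕ.≟ k) g (sublists xs))) ⟩
  (∑[ k ∈ upTo m ] c k * (∑[ S ∈ sublists xs ] 𝟙 (length S ℕ.≟ k) * g S))
    ≡⟨ ∑-cong (upTo m) (λ {k} _ → sym (∑-*ˡ (c k) _ (sublists xs))) ⟩
  (∑[ k ∈ upTo m ] ∑[ S ∈ sublists xs ] c k * (𝟙 (length S ℕ.≟ k) * g S))
    ≡⟨ ∑-swap (λ k S → c k * (𝟙 (length S ℕ.≟ k) * g S)) (upTo m) (sublists xs) ⟩
  (∑[ S ∈ sublists xs ] ∑[ k ∈ upTo m ] c k * (𝟙 (length S ℕ.≟ k) * g S))
    ≡⟨ ∑-cong (sublists xs) (λ {S} S∈ → trans
         (∑-cong (upTo m) (λ {k} _ → rearrange (c k) (𝟙 (length S ℕ.≟ k)) (g S)))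
         (∑-pick ℕ._≟_ (λ k → c k * g S) (Unique.upTo⁺ m)
           (List.∈-upTo⁺ (ℕ.≤-<-trans (length-sublist xs S∈) xs<m)))) ⟩
  (∑[ S ∈ sublists xs ] c (length S) * g S) ∎
  where
  open ≡-Reasoning
  open +-*-Solver
  rearrange : ∀ a b d → a * (b * d) ≡ b * (a * d)
  rearrange = solve 3 (λ a b d → a :* (b :* d) := b :* (a :* d)) refl

-- Counts and fractions as rationals

ι : ℕ → ℚ
ι k = + k / 1

/-≡ : ∀ a b c d .{{_ : NonZero b}} .{{_ : NonZero d}} →
      + a ℤ.* + d ≡ + c ℤ.* + b → + a / b ≡ + c / d
/-≡ a (suc b) c (suc d) eq = fromℚᵘ-cong {ℚᵘ.mkℚᵘ (+ a) b} {ℚᵘ.mkℚᵘ (+ c) d} (ℚᵘ.*≡* eq)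

-- Checked on unnormalised rationals, where equality is cross-multiplication and no reduction to
-- lowest terms interferes.
/-*-ι : ∀ a b .{{_ : NonZero b}} → + a / b ≡ ι a * (+ 1 / b)
/-*-ι a (suc b) = toℚᵘ-injective (begin
  toℚᵘ (+ a / suc b)
    ≈⟨ toℚᵘ-fromℚᵘ (ℚᵘ.mkℚᵘ (+ a) b) ⟩
  ℚᵘ.mkℚᵘ (+ a) b
    ≈⟨ ℚᵘ.*≡* (cong₂ ℤ._*_ (sym (ℤ.*-identityʳ (+ a)))
         (cong +_ (ℕ.*-identityˡ (suc b)))) ⟩
  ℚᵘ.mkℚᵘ (+ a) 0 ℚᵘ.* ℚᵘ.mkℚᵘ (+ 1) b
    ≈⟨ ℚᵘ.*-cong (toℚᵘ-fromℚᵘ (ℚᵘ.mkℚᵘ (+ a) 0)) (toℚᵘ-fromℚᵘ (ℚᵘ.mkℚᵘ (+ 1) b)) ⟨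
  toℚᵘ (ι a) ℚᵘ.* toℚᵘ (+ 1 / suc b)
    ≈⟨ toℚᵘ-homo-* (ι a) (+ 1 / suc b) ⟨
  toℚᵘ (ι a * (+ 1 / suc b)) ∎)
  where open ℚᵘ.≃-Reasoning

ι-*-1/ : ∀ b .{{_ : NonZero b}} → ι b * (+ 1 / b) ≡ 1ℚ
ι-*-1/ b = trans (sym (/-*-ι b b)) (/-≡ b b 1 1 (ℤ.*-comm (+ b) (+ 1)))

ι-suc : ∀ k → ι (suc k) ≡ 1ℚ + ι k
ι-suc k = toℚᵘ-injective (begin
  toℚᵘ (ι (suc k))
    ≈⟨ toℚᵘ-fromℚᵘ (ℚᵘ.mkℚᵘ (+ suc k) 0) ⟩
  ℚᵘ.mkℚᵘ (+ suc k) 0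
    ≈⟨ ℚᵘ.*≡* (cong (λ i → (+ 1 ℤ.+ i) ℤ.* + 1) (sym (ℤ.*-identityʳ (+ k)))) ⟩
  toℚᵘ 1ℚ ℚᵘ.+ ℚᵘ.mkℚᵘ (+ k) 0
    ≈⟨ ℚᵘ.+-congʳ (toℚᵘ 1ℚ) (toℚᵘ-fromℚᵘ (ℚᵘ.mkℚᵘ (+ k) 0)) ⟨
  toℚᵘ 1ℚ ℚᵘ.+ toℚᵘ (ι k)
    ≈⟨ toℚᵘ-homo-+ 1ℚ (ι k) ⟨
  toℚᵘ (1ℚ + ι k) ∎)
  where open ℚᵘ.≃-Reasoning

ι-length : (xs : List A) → ι (length xs) ≡ (∑[ _ ∈ xs ] 1ℚ)
ι-length []       = refl
ι-length (x ∷ xs) = trans (ι-suc (length xs)) (cong (_+_ 1ℚ) (ι-length xs))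

ι-filter : ∀ {P : Pred A _} (P? : Decidable P) xs → ι (length (filter P? xs)) ≡ (∑[ x ∈ xs ] 𝟙 (P? x))
ι-filter P? xs = begin
  ι (length (filter P? xs))    ≡⟨ ι-length (filter P? xs) ⟩
  (∑[ _ ∈ filter P? xs ] 1ℚ)   ≡⟨ ∑-filter P? (λ _ → 1ℚ) xs ⟩
  (∑[ x ∈ xs ] 𝟙 (P? x) * 1ℚ)  ≡⟨ ∑-cong xs (λ {x} _ → *-identityʳ (𝟙 (P? x))) ⟩
  (∑[ x ∈ xs ] 𝟙 (P? x))       ∎
  where open ≡-Reasoning

ι-∣∣ : (U : Subset n) → ι ∣ U ∣ ≡ (∑[ e ∈ allFin n ] 𝟙 (e ∈? U))
ι-∣∣ [] = refl
ι-∣∣ {suc n} (s ∷ U) = trans (head+tail s) (cong (λ r → 𝟙 (zero ∈? (s ∷ U)) + r) (begin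
  -- `∑-map` fits because `does (suc e ∈? (s ∷ U))` computes to `does (e ∈? U)`.
  (∑[ e ∈ allFin n ] 𝟙 (e ∈? U))                      ≡⟨ ∑-map suc (λ e → 𝟙 (e ∈? (s ∷ U))) (allFin n) ⟨
  (∑[ e ∈ List.map suc (allFin n) ] 𝟙 (e ∈? (s ∷ U)))
    ≡⟨ cong (λ es → ∑[ e ∈ es ] 𝟙 (e ∈? (s ∷ U))) (List.map-tabulate id suc) ⟩
  (∑[ e ∈ List.tabulate suc ] 𝟙 (e ∈? (s ∷ U)))       ∎))
  where
  open ≡-Reasoning
  head+tail : ∀ s → ι ∣ s ∷ U ∣ ≡ 𝟙 (zero ∈? (s ∷ U)) + (∑[ e ∈ allFin n ] 𝟙 (e ∈? U))
  head+tail inside  = trans (ι-suc ∣ U ∣) (cong (_+_ 1ℚ) (ι-∣∣ U))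
  head+tail outside = trans (ι-∣∣ U) (sym (+-identityˡ _))

-- Finite index sets

-- Pigeonhole: if `y` were missed, punching it out of the codomain would inject `Fin (suc n)` into
-- `Fin n`.
injective⇒surjective : ∀ {f : Fin n → Fin n} → (∀ {i j} → f i ≡ f j → i ≡ j) →
                       ∀ y → ∃ λ x → f x ≡ y
injective⇒surjective {suc n} {f} f-inj y with Fin.any? (λ x → f x Fin.≟ y)
... | yes hit = hit
... | no miss = contradiction (Fin.injective⇒≤ avoid-injective) ℕ.1+n≰n
  where
  y≢f : ∀ x → y ≢ f x
  y≢f x y≡fx = miss (x , sym y≡fx)

  avoid : Fin (suc n) → Fin n
  avoid x = punchOut (y≢f x)

  avoid-injective : ∀ {i j} → avoid i ≡ avoid j → i ≡ j
  avoid-injective {i} {j} = f-inj ∘ Fin.punchOut-injective (y≢f i) (y≢f j)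

-- Successors are searched first; `zero` is the answer only when none of them satisfies `P`.
greatest : ∀ {P : Pred (Fin m) p} → Decidable P → ∃ P → ∃ λ i → P i × (∀ j → P j → j Fin.≤ i)
greatest {m = suc m} {P = P} P? (i , pi) with Fin.any? (P? ∘ suc)
... | yes later with i′ , pi′ , max ← greatest (P? ∘ suc) later =
  suc i′ , pi′ , λ { zero _ → ℕ.z≤n ; (suc j) pj → s≤s (max j pj) }
... | no ¬later = zero , at-zero i pi , λ { zero _ → ℕ.z≤n ; (suc j) pj → contradiction (j , pj) ¬later }
  where
  at-zero : ∀ i → P i → P zero
  at-zero zero    p₀ = p₀
  at-zero (suc j) pj = contradiction (j , pj) ¬later

-- Orders

words-unique : ∀ {xs : List A} → List.Unique xs → ∀ k → List.Unique (words xs k)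
words-unique xs! zero    = [] ∷ []
words-unique xs! (suc k) = Unique.cartesianProductWith⁺ _∷_ Vec.∷-injective xs! (words-unique xs! k)

orders-unique : ∀ n → List.Unique (orders n)
orders-unique n = Unique.filter⁺ unique? (words-unique (Unique.allFin⁺ n) n)

∈-orders : {σ : Vec (Fin n) n} → σ List.∈ orders n ⇔ Injective σ
∈-orders {n} {σ} = mk⇔
  (proj₂ ∘ List.∈-filter⁻ unique? {xs = words (allFin n) n})
  (List.∈-filter⁺ unique? (∈-words List.∈-allFin σ))

module _ {σ : Vec (Fin n) n} (σ∈ : σ List.∈ orders n) where

  order-injective : ∀ {i j} → lookup σ i ≡ lookup σ j → i ≡ j
  order-injective = Vec.lookup-injective (to ∈-orders σ∈) _ _

  order-surjective : ∀ x → ∃ λ i → lookup σ i ≡ x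
  order-surjective = injective⇒surjective order-injective

-- Both lists are duplicate-free with the same members, hence equal as bags. This is the invariance
-- of the uniform distribution under relabelling the ground set.
relabel-orders : ∀ (π π⁻¹ : Fin n → Fin n) → (∀ x → π (π⁻¹ x) ≡ x) → (∀ x → π⁻¹ (π x) ≡ x) →
                 List.map (Vec.map π) (orders n) ↭ orders n
relabel-orders {n} π π⁻¹ ππ⁻¹ π⁻¹π = ∼bag⇒↭ (unique∧set⇒bag
  (Unique.map⁺ (λ {σ} {τ} eq → trans (sym (cancel π⁻¹π σ)) (trans (cong (Vec.map π⁻¹) eq) (cancel π⁻¹π τ)))
    (orders-unique n))
  (orders-unique n)
  (mk⇔ relabelled⇒order order⇒relabelled))
  where
  cancel : ∀ {g h : Fin n → Fin n} → (∀ x → g (h x) ≡ x) →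
           ∀ {m} (τ : Vec (Fin n) m) → Vec.map g (Vec.map h τ) ≡ τ
  cancel {g} {h} gh τ = trans (sym (Vec.map-∘ g h τ)) (trans (Vec.map-cong gh τ) (Vec.map-id τ))

  injective : ∀ g {h : Fin n → Fin n} → (∀ x → g (h x) ≡ x) → ∀ {x y} → h x ≡ h y → x ≡ y
  injective g gh {x} {y} eq = trans (sym (gh x)) (trans (cong g eq) (gh y))

  relabelled⇒order : ∀ {σ} → σ List.∈ List.map (Vec.map π) (orders n) → σ List.∈ orders n
  relabelled⇒order σ∈ with τ , τ∈ , refl ← List.∈-map⁻ (Vec.map π) σ∈ =
    from ∈-orders (Vec.map⁺ (injective π⁻¹ π⁻¹π) (to ∈-orders τ∈))

  order⇒relabelled : ∀ {σ} → σ List.∈ orders n → σ List.∈ List.map (Vec.map π) (orders n)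
  order⇒relabelled {σ} σ∈ = subst (List._∈ _) (cancel ππ⁻¹ σ)
    (List.∈-map⁺ (Vec.map π) (from ∈-orders (Vec.map⁺ (injective π ππ⁻¹) (to ∈-orders σ∈))))

-- The last called element of a set

-- The position is recorded rather than the element, so that it can be compared with rounds.
IsLast : Subset n → Vec (Fin n) m → Pred (Fin m) _
IsLast U σ i = lookup σ i ∈ U × (∀ j → lookup σ j ∈ U → j Fin.≤ i)

EndsIn : Subset n → Subset n → Pred (Vec (Fin n) m) _
EndsIn U C σ = ∃ λ i → IsLast U σ i × lookup σ i ∈ C

endsIn? : (U C : Subset n) → Decidable (EndsIn {m = m} U C)
endsIn? U C σ = Fin.any? λ i →
  (lookup σ i ∈? U ×-dec Fin.all? (λ j → lookup σ j ∈? U →-dec (j Fin.≤? i))) ×-dec lookup σ i ∈? C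

-- An order calls every element, in particular `x`, so some position carries an element of `U` and a
-- greatest one exists.
last-exists : ∀ {U : Subset n} {σ} → σ List.∈ orders n → ∀ {x} → x ∈ U → ∃ (IsLast U σ)
last-exists {U = U} {σ} σ∈ {x} x∈U with i , refl ← order-surjective σ∈ x =
  greatest (λ j → lookup σ j ∈? U) (i , x∈U)

-- Two last positions bound each other, so the witness inside `EndsIn` must be `i`.
EndsIn-IsLast : ∀ {U C : Subset n} (σ : Vec (Fin n) m) {i} → IsLast U σ i →
                EndsIn U C σ ⇔ lookup σ i ∈ C
EndsIn-IsLast {C = C} σ {i} last@(i∈U , max) = mk⇔
  (λ { (j , (j∈U , max′) , j∈C) →
       subst (λ k → lookup σ k ∈ C) (Fin.≤-antisym (max j j∈U) (max′ i i∈U)) j∈C })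
  (λ i∈C → i , last , i∈C)

-- Since `π` preserves membership in `U`, relabelling keeps the last position of `U` and only
-- changes the letter there from `e` to `π e`.
EndsIn-relabel : ∀ {U : Subset n} {π : Fin n → Fin n} → (∀ {x y} → π x ≡ π y → x ≡ y) →
                 (∀ {x} → π x ∈ U ⇔ x ∈ U) → ∀ {e} (σ : Vec (Fin n) m) →
                 EndsIn U ⁅ π e ⁆ (Vec.map π σ) ⇔ EndsIn U ⁅ e ⁆ σ
EndsIn-relabel {U = U} {π} π-inj π-U {e} σ = mk⇔
  (λ { (i , (i∈U , max) , i∈e) → i ,
       (to π-U (subst (_∈ U) (at i) i∈U) , λ j j∈U → max j (subst (_∈ U) (sym (at j)) (from π-U j∈U))) ,
       subst (_∈ ⁅ e ⁆) (sym (π-inj (trans (sym (at i)) (x∈⁅y⁆⇒x≡y (π e) i∈e)))) (x∈⁅x⁆ e) })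
  (λ { (i , (i∈U , max) , i∈e) → i ,
       (subst (_∈ U) (sym (at i)) (from π-U i∈U) , λ j j∈U → max j (to π-U (subst (_∈ U) (at j) j∈U))) ,
       subst (_∈ ⁅ π e ⁆) (sym (trans (at i) (cong π (x∈⁅y⁆⇒x≡y e i∈e)))) (x∈⁅x⁆ (π e)) })
  where
  at : ∀ i → lookup (Vec.map π σ) i ≡ π (lookup σ i)
  at i = Vec.lookup-map i π σ

transpose-left : ∀ (e f : Fin n) → Perm.transpose e f e ≡ f
transpose-left e f rewrite dec-true (e Fin.≟ e) refl = refl

transpose-closed : ∀ {U : Subset n} {e f} → e ∈ U → f ∈ U → ∀ {x} → x ∈ U → Perm.transpose e f x ∈ U
transpose-closed {e = e} {f} e∈U f∈U {x} x∈U with does (x Fin.≟ e)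
... | Bool.true  = f∈U
... | Bool.false with does (x Fin.≟ f)
...   | Bool.true  = e∈U
...   | Bool.false = x∈U

#EndsIn : Subset n → Subset n → ℚ
#EndsIn {n} U C = ∑[ σ ∈ orders n ] 𝟙 (endsIn? U C σ)

-- Transposing `e` and `f` preserves `U` and permutes the orders, matching those that end `U` in `e`
-- with those that end it in `f`.
#EndsIn-symmetric : ∀ {U : Subset n} {e f} → e ∈ U → f ∈ U → #EndsIn U ⁅ e ⁆ ≡ #EndsIn U ⁅ f ⁆
#EndsIn-symmetric {n} {U} {e} {f} e∈U f∈U = begin
  (∑[ σ ∈ orders n ] 𝟙 (endsIn? U ⁅ e ⁆ σ))
    ≡⟨ ∑-cong (orders n) (λ {σ} _ → 𝟙-cong (EndsIn-relabel π-injective π-U σ)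
         (endsIn? U ⁅ π e ⁆ (Vec.map π σ)) (endsIn? U ⁅ e ⁆ σ)) ⟨
  (∑[ σ ∈ orders n ] 𝟙 (endsIn? U ⁅ π e ⁆ (Vec.map π σ)))
    ≡⟨ cong (λ g → ∑[ σ ∈ orders n ] 𝟙 (endsIn? U ⁅ g ⁆ (Vec.map π σ))) (transpose-left e f) ⟩
  (∑[ σ ∈ orders n ] 𝟙 (endsIn? U ⁅ f ⁆ (Vec.map π σ)))
    ≡⟨ ∑-map (Vec.map π) (λ σ → 𝟙 (endsIn? U ⁅ f ⁆ σ)) (orders n) ⟨
  (∑[ σ ∈ List.map (Vec.map π) (orders n) ] 𝟙 (endsIn? U ⁅ f ⁆ σ))
    ≡⟨ ∑-↭ (λ σ → 𝟙 (endsIn? U ⁅ f ⁆ σ))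
         (relabel-orders π (Perm.transpose f e)
           (λ _ → Perm.transpose-inverse e f) (λ _ → Perm.transpose-inverse f e)) ⟩
  (∑[ σ ∈ orders n ] 𝟙 (endsIn? U ⁅ f ⁆ σ)) ∎
  where
  open ≡-Reasoning
  π = Perm.transpose e f

  π-injective : ∀ {x y} → π x ≡ π y → x ≡ y
  π-injective eq = trans (sym (Perm.transpose-inverse f e))
    (trans (cong (Perm.transpose f e) eq) (Perm.transpose-inverse f e))

  π-U : ∀ {x} → π x ∈ U ⇔ x ∈ U
  π-U = mk⇔
    (subst (_∈ U) (Perm.transpose-inverse f e) ∘ transpose-closed f∈U e∈U)
    (transpose-closed e∈U f∈U)

-- Each order has exactly one last element of the non-empty set `U`; sorting the orders by it splits
-- the event into disjoint cases.
#EndsIn-split : ∀ {U : Subset n} C {x} → x ∈ U →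
                #EndsIn U C ≡ (∑[ e ∈ allFin n ] 𝟙 (e ∈? C) * #EndsIn U ⁅ e ⁆)
#EndsIn-split {n} {U} C x∈U = begin
  (∑[ σ ∈ orders n ] 𝟙 (endsIn? U C σ))
    ≡⟨ ∑-cong (orders n) split ⟩
  (∑[ σ ∈ orders n ] ∑[ e ∈ allFin n ] 𝟙 (e ∈? C) * 𝟙 (endsIn? U ⁅ e ⁆ σ))
    ≡⟨ ∑-swap (λ σ e → 𝟙 (e ∈? C) * 𝟙 (endsIn? U ⁅ e ⁆ σ)) (orders n) (allFin n) ⟩
  (∑[ e ∈ allFin n ] ∑[ σ ∈ orders n ] 𝟙 (e ∈? C) * 𝟙 (endsIn? U ⁅ e ⁆ σ))
    ≡⟨ ∑-cong (allFin n) (λ {e} _ → ∑-*ˡ (𝟙 (e ∈? C)) (λ σ → 𝟙 (endsIn? U ⁅ e ⁆ σ)) (orders n)) ⟩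
  (∑[ e ∈ allFin n ] 𝟙 (e ∈? C) * #EndsIn U ⁅ e ⁆) ∎
  where
  open ≡-Reasoning
  split : ∀ {σ} → σ List.∈ orders n →
          𝟙 (endsIn? U C σ) ≡ (∑[ e ∈ allFin n ] 𝟙 (e ∈? C) * 𝟙 (endsIn? U ⁅ e ⁆ σ))
  split {σ} σ∈ with i , last ← last-exists σ∈ x∈U = begin
    𝟙 (endsIn? U C σ)
      ≡⟨ 𝟙-cong (EndsIn-IsLast σ last) (endsIn? U C σ) (lookup σ i ∈? C) ⟩
    𝟙 (lookup σ i ∈? C)
      -- A delta at the last element is inserted; it is then read as the event that `U` ends in `e`.
      ≡⟨ ∑-pick Fin._≟_ (λ e → 𝟙 (e ∈? C)) (Unique.allFin⁺ n) (List.∈-allFin (lookup σ i)) ⟨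
    (∑[ e ∈ allFin n ] 𝟙 (lookup σ i Fin.≟ e) * 𝟙 (e ∈? C))
      ≡⟨ ∑-cong (allFin n) (λ {e} _ → trans (*-comm (𝟙 (lookup σ i Fin.≟ e)) (𝟙 (e ∈? C))) (cong (𝟙 (e ∈? C) *_)
           (𝟙-cong (mk⇔
             (λ { refl → from (EndsIn-IsLast σ last) (x∈⁅x⁆ e) })
             (x∈⁅y⁆⇒x≡y e ∘ to (EndsIn-IsLast σ last)))
             (lookup σ i Fin.≟ e) (endsIn? U ⁅ e ⁆ σ)))) ⟩
    (∑[ e ∈ allFin n ] 𝟙 (e ∈? C) * 𝟙 (endsIn? U ⁅ e ⁆ σ)) ∎

-- By symmetry the elements of `C` contribute equal counts, all equal to that of the reference
-- element `x`.
#EndsIn-⊆ : ∀ {U C : Subset n} {x} → x ∈ U → C ⊆ U → #EndsIn U C ≡ ι ∣ C ∣ * #EndsIn U ⁅ x ⁆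
#EndsIn-⊆ {n} {U} {C} {x} x∈U C⊆U = begin
  #EndsIn U C
    ≡⟨ #EndsIn-split C x∈U ⟩
  (∑[ e ∈ allFin n ] 𝟙 (e ∈? C) * #EndsIn U ⁅ e ⁆)
    ≡⟨ ∑-cong (allFin n) (λ {e} _ → same e) ⟩
  (∑[ e ∈ allFin n ] 𝟙 (e ∈? C) * #EndsIn U ⁅ x ⁆)
    ≡⟨ ∑-*ʳ (#EndsIn U ⁅ x ⁆) (λ e → 𝟙 (e ∈? C)) (allFin n) ⟩
  (∑[ e ∈ allFin n ] 𝟙 (e ∈? C)) * #EndsIn U ⁅ x ⁆
    ≡⟨ cong (_* #EndsIn U ⁅ x ⁆) (ι-∣∣ C) ⟨
  ι ∣ C ∣ * #EndsIn U ⁅ x ⁆ ∎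
  where
  open ≡-Reasoning
  same : ∀ e → 𝟙 (e ∈? C) * #EndsIn U ⁅ e ⁆ ≡ 𝟙 (e ∈? C) * #EndsIn U ⁅ x ⁆
  -- Outside `C` the indicator vanishes, so symmetry is invoked only for `e ∈ C ⊆ U`.
  same e with e ∈? C
  ... | yes e∈C = cong (1ℚ *_) (#EndsIn-symmetric (C⊆U e∈C) x∈U)
  ... | no  _   = trans (*-zeroˡ (#EndsIn U ⁅ e ⁆)) (sym (*-zeroˡ (#EndsIn U ⁅ x ⁆)))

-- The last element of `U` always lies in `U`, so every order is counted.
#EndsIn-self : ∀ {U : Subset n} {x} → x ∈ U → #EndsIn U U ≡ ι (length (orders n))
#EndsIn-self {n} {U} x∈U = trans
  (∑-cong (orders n) (λ {σ} σ∈ → 𝟙-yes (endsIn? U U σ)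
    (let i , last = last-exists σ∈ x∈U in i , last , proj₁ last)))
  (sym (ι-length (orders n)))

Pr-EndsIn : ∀ {U C : Subset n} .{{_ : NonZero (length (orders n))}} .{{_ : NonZero ∣ U ∣}} {x} →
            x ∈ U → C ⊆ U → #EndsIn U C * (+ 1 / length (orders n)) ≡ + ∣ C ∣ / ∣ U ∣
Pr-EndsIn {n} {U} {C} {x} x∈U C⊆U = begin
  #EndsIn U C * r              ≡⟨ cong (_* r) (#EndsIn-⊆ x∈U C⊆U) ⟩
  ι ∣ C ∣ * c * r              ≡⟨ *-identityʳ (ι ∣ C ∣ * c * r) ⟨
  -- The common count `c` is never divided out: 1 is expanded as `∣ U ∣` times its inverse, and
  -- `∣ U ∣` times `c` is the number of all orders, by the case `C = U`.
  ι ∣ C ∣ * c * r * 1ℚ         ≡⟨ cong (ι ∣ C ∣ * c * r *_) (ι-*-1/ ∣ U ∣) ⟨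
  ι ∣ C ∣ * c * r * (ι ∣ U ∣ * u)
    ≡⟨ solve 5 (λ a c r b u → a :* c :* r :* (b :* u) := a :* u :* (b :* c :* r)) refl
         (ι ∣ C ∣) c r (ι ∣ U ∣) u ⟩
  ι ∣ C ∣ * u * (ι ∣ U ∣ * c * r)
    ≡⟨ cong (λ z → ι ∣ C ∣ * u * (z * r)) (trans (sym (#EndsIn-⊆ x∈U id)) (#EndsIn-self x∈U)) ⟩
  ι ∣ C ∣ * u * (ι (length (orders n)) * r)
    ≡⟨ cong (ι ∣ C ∣ * u *_) (ι-*-1/ (length (orders n))) ⟩
  ι ∣ C ∣ * u * 1ℚ             ≡⟨ *-identityʳ (ι ∣ C ∣ * u) ⟩
  ι ∣ C ∣ * u                  ≡⟨ /-*-ι ∣ C ∣ ∣ U ∣ ⟨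
  + ∣ C ∣ / ∣ U ∣              ∎
  where
  open ≡-Reasoning
  open +-*-Solver
  c = #EndsIn U ⁅ x ⁆
  r = + 1 / length (orders n)
  u = + 1 / ∣ U ∣

-- Called sets

-- The body of `called` is written out because induction on `σ` needs a length `m` independent of
-- `n`. Positions start at 0, so the first `t` calls are those with `toℕ j < t`.
∈-called⁺ : ∀ (σ : Vec (Fin n) m) t {j} → toℕ j ℕ.< t →
            lookup σ j ∈ ⋃ (List.map ⁅_⁆ (List.take t (Vec.toList σ)))
∈-called⁺ (x ∷ σ) (suc t) {zero}  _         = Subset.x∈p∪q⁺ (inj₁ (x∈⁅x⁆ x))
∈-called⁺ (x ∷ σ) (suc t) {suc j} (s<s j<t) = Subset.x∈p∪q⁺ (inj₂ (∈-called⁺ σ t j<t))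

∈-called⁻ : ∀ (σ : Vec (Fin n) m) t {x} → x ∈ ⋃ (List.map ⁅_⁆ (List.take t (Vec.toList σ))) →
            ∃ λ j → toℕ j ℕ.< t × lookup σ j ≡ x
∈-called⁻ σ       zero    x∈ = contradiction x∈ Subset.∉⊥
∈-called⁻ []      (suc t) x∈ = contradiction x∈ Subset.∉⊥
∈-called⁻ (y ∷ σ) (suc t) x∈ with Subset.x∈p∪q⁻ ⁅ y ⁆ _ x∈
... | inj₁ x∈⁅y⁆ = zero , z<s , sym (x∈⁅y⁆⇒x≡y y x∈⁅y⁆)
... | inj₂ x∈σ with j , j<t , eq ← ∈-called⁻ σ t x∈σ = suc j , s<s j<t , eq

called-mono : ∀ (σ : Vec (Fin n) n) {s t} → s ℕ.≤ t → called σ s ⊆ called σ t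
called-mono σ {s} {t} s≤t x∈ with j , j<s , refl ← ∈-called⁻ σ s x∈ = ∈-called⁺ σ t (ℕ.<-≤-trans j<s s≤t)

module _ {σ : Vec (Fin n) n} (σ∈ : σ List.∈ orders n) where

  -- The letter was called at some position before `t`; injectivity identifies that position with
  -- `j`.
  lookup∈called : ∀ {t j} → lookup σ j ∈ called σ t → toℕ j ℕ.< t
  lookup∈called {t} σj∈ with k , k<t , eq ← ∈-called⁻ σ t σj∈ =
    subst (λ l → toℕ l ℕ.< t) (order-injective σ∈ eq) k<t

  ⊆-called : ∀ {U : Subset n} {t} → (∀ j → lookup σ j ∈ U → toℕ j ℕ.< t) → U ⊆ called σ t
  ⊆-called {t = t} before {x} x∈U with j , refl ← order-surjective σ∈ x = ∈-called⁺ σ t (before j x∈U)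

  -- The round `suc (toℕ i)` adds only the letter `lookup σ i`, so a set avoiding it was already
  -- complete.
  ⊆-called-pred : ∀ {U : Subset n} {i} → U ⊆ called σ (suc (toℕ i)) → lookup σ i ∉ U → U ⊆ called σ (toℕ i)
  ⊆-called-pred {U} {i} U⊆ σi∉U = ⊆-called λ j σj∈U →
    ℕ.≤∧≢⇒< (ℕ.s≤s⁻¹ (lookup∈called (U⊆ σj∈U)))
      (λ j≡i → σi∉U (subst (λ k → lookup σ k ∈ U) (Fin.toℕ-injective j≡i) σj∈U))

  last-called : ∀ {C : Subset n} {i} → IsLast C σ i → C ⊆ called σ (suc (toℕ i))
  last-called (_ , max) = ⊆-called (λ j σj∈C → s≤s (max j σj∈C))

∈-⋃ : ∀ (S : List (Subset n)) {x} → x ∈ ⋃ S ⇔ Any (x ∈_) S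
∈-⋃ S = mk⇔ (⋃⇒Any S) (Any⇒⋃ S)
  where
  ⋃⇒Any : ∀ (S : List (Subset n)) {x} → x ∈ ⋃ S → Any (x ∈_) S
  ⋃⇒Any []      x∈ = contradiction x∈ Subset.∉⊥
  ⋃⇒Any (D ∷ S) x∈ = [ here , there ∘ ⋃⇒Any S ]′ (Subset.x∈p∪q⁻ D (⋃ S) x∈)

  Any⇒⋃ : ∀ (S : List (Subset n)) {x} → Any (x ∈_) S → x ∈ ⋃ S
  Any⇒⋃ (D ∷ S) (here x∈D)  = Subset.x∈p∪q⁺ (inj₁ x∈D)
  Any⇒⋃ (D ∷ S) (there x∈S) = Subset.x∈p∪q⁺ (inj₂ (Any⇒⋃ S x∈S))

-- If the last position `k` of the union carries an element of `C`, then `k ≤ i`, so all of `S` is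
-- called by then. Conversely, if nothing in `S` comes after `i`, then `i` is the last position of
-- the union, and its letter lies in `C`.
EndsIn-⋃ : ∀ {C : Subset n} {σ} → σ List.∈ orders n → ∀ {i} → IsLast C σ i → ∀ S →
           EndsIn (⋃ S ∪ C) C σ ⇔ All (_⊆ called σ (suc (toℕ i))) S
EndsIn-⋃ {C = C} {σ} σ∈ {i} (σi∈C , max) S = mk⇔
  (λ { (k , (_ , maxU) , σk∈C) → All.tabulate λ D∈S → ⊆-called σ∈ λ j σj∈D →
         s≤s (ℕ.≤-trans
           (maxU j (Subset.x∈p∪q⁺ (inj₁ (from (∈-⋃ S) (lose D∈S σj∈D)))))
           (max k σk∈C)) })
  (λ S⊆ → i , (Subset.x∈p∪q⁺ (inj₂ σi∈C) , λ j σj∈U →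
     [ (λ σj∈⋃ → let D , D∈S , σj∈D = find (to (∈-⋃ S) σj∈⋃) in
          ℕ.s≤s⁻¹ (lookup∈called σ∈ (All.lookup S⊆ D∈S σj∈D)))
     , max j ]′ (Subset.x∈p∪q⁻ (⋃ S) C σj∈U)) , σi∈C)

-- Circuits and the winning condition

x∉p-x : ∀ (p : Subset n) {x} → x ∉ p Subset.- x
x∉p-x (_       ∷ p) {suc x} (Vec.there x∈) = x∉p-x p x∈
x∉p-x (inside  ∷ p) {zero} ()
x∉p-x (outside ∷ p) {zero} ()

∈-circuits : ∀ (M : Matroid n) {D} → D List.∈ circuits M ⇔ Circuit M D
∈-circuits {n} M {D} = mk⇔
  (proj₂ ∘ List.∈-filter⁻ (circuit? M) {xs = words (Bool.true ∷ Bool.false ∷ []) n})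
  (List.∈-filter⁺ (circuit? M) (∈-words (λ { Bool.true → here refl ; Bool.false → there (here refl) }) D))

-- If another circuit D is complete together with C, then either D avoids the last
-- called element, or eliminating it from C and D gives a circuit completed earlier.
Wins⇔ : ∀ (M : Matroid n) {C σ} → Circuit M C → σ List.∈ orders n → ∀ {i} → IsLast C σ i →
        Wins M C σ ⇔ All (λ D → ¬ D ⊆ called σ (suc (toℕ i))) (circuits M ∖ C)
Wins⇔ M {C} {σ} isC σ∈ {i} last@(σi∈C , _) = mk⇔
  (λ { (k , C⊆ , free) → All.tabulate λ {D} D∈ D⊆ →
         let D∈M , D≢C = List.∈-filter⁻ (λ D → ¬? (D ≟ˢ C)) {xs = circuits M} D∈
             -- The winning round completes `C`, hence comes no earlier than the call of its last
             -- element.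
             i≤k = ℕ.s≤s⁻¹ (lookup∈called σ∈ (C⊆ σi∈C))
             F , isF , F⊆ = earlier (to (∈-circuits M) D∈M) D≢C D⊆
         in free (F , isF , called-mono σ i≤k ∘ F⊆) })
  (λ none → i , (λ {x} → last-called σ∈ last {x}) , λ { (D , isD , D⊆) → first none isD D⊆ (D ≟ˢ C) })
  where
  earlier : ∀ {D} → Circuit M D → D ≢ C → D ⊆ called σ (suc (toℕ i)) → ContainsCircuit M (called σ (toℕ i))
  earlier {D} isD D≢C D⊆ with lookup σ i ∈? D
  ... | no  σi∉D = D , isD , ⊆-called-pred σ∈ D⊆ σi∉D
  ... | yes σi∈D
    with F , isF , F⊆ ← elimination M isC isD (D≢C ∘ sym) (Subset.x∈p∩q⁺ (σi∈C , σi∈D)) =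
    F , isF , ⊆-called-pred σ∈
      (λ x∈F → [ last-called σ∈ last , D⊆ ]′
        (Subset.x∈p∪q⁻ C D (Subset.p─q⊆p (C ∪ D) ⁅ lookup σ i ⁆ (F⊆ x∈F))))
      (λ σi∈F → x∉p-x (C ∪ D) (F⊆ σi∈F))

  first : All (λ D → ¬ D ⊆ called σ (suc (toℕ i))) (circuits M ∖ C) →
          ∀ {D} → Circuit M D → D ⊆ called σ (toℕ i) → ¬ Dec (D ≡ C)
  -- `C` itself cannot be complete before its own last element is called.
  first _    _   D⊆ (yes refl) = ℕ.<-irrefl refl (lookup∈called σ∈ (D⊆ σi∈C))
  first none isD D⊆ (no D≢C)   = All.lookup none
    (List.∈-filter⁺ (λ D → ¬? (D ≟ˢ C)) (from (∈-circuits M) isD) D≢C)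
    (called-mono σ (ℕ.n≤1+n (toℕ i)) ∘ D⊆)

circuit-nonempty : ∀ (M : Matroid n) {C} → Circuit M C → Subset.Nonempty C
circuit-nonempty M {C} isC with Subset.nonempty? C
... | yes nonempty = nonempty
... | no  empty    = contradiction (subst (Circuit M) (Subset.Empty-unique empty) isC) (⊥-notCircuit M)

-- The completion round of `C` varies with `σ`. Rewriting "all of `S` is complete by then" as
-- `endsIn?` removes that round, so the sums over `σ` and `S` can later be exchanged.
𝟙-wins : ∀ (M : Matroid n) {C} → Circuit M C → ∀ {σ} → σ List.∈ orders n →
         𝟙 (wins? M C σ) ≡
         (∑[ S ∈ sublists (circuits M ∖ C) ] (- 1ℚ) ^ length S * 𝟙 (endsIn? (⋃ S ∪ C) C σ))
𝟙-wins M {C} isC {σ} σ∈ with i , last ← last-exists σ∈ (proj₂ (circuit-nonempty M isC)) = begin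
  𝟙 (wins? M C σ)
    ≡⟨ 𝟙-cong (Wins⇔ M isC σ∈ last) (wins? M C σ) (All.all? (¬? ∘ done?) (circuits M ∖ C)) ⟩
  𝟙 (All.all? (¬? ∘ done?) (circuits M ∖ C))
    ≡⟨ inclusion-exclusion done? (circuits M ∖ C) ⟩
  (∑[ S ∈ sublists (circuits M ∖ C) ] (- 1ℚ) ^ length S * 𝟙 (All.all? done? S))
    ≡⟨ ∑-cong (sublists (circuits M ∖ C)) (λ {S} _ → cong ((- 1ℚ) ^ length S *_)
         (𝟙-cong (EndsIn-⋃ σ∈ last S) (endsIn? (⋃ S ∪ C) C σ) (All.all? done? S))) ⟨
  (∑[ S ∈ sublists (circuits M ∖ C) ] (- 1ℚ) ^ length S * 𝟙 (endsIn? (⋃ S ∪ C) C σ)) ∎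
  where
  open ≡-Reasoning
  done? : Decidable (_⊆ called σ (suc (toℕ i)))
  done? D = D ⊆? called σ (suc (toℕ i))

-- The winning probability

theorem1 : (n : ℕ) (M : Matroid n) (C : Subset n) (isC : Circuit M C) →
    β M C ≡
    (∑[ k ∈ upTo (length (circuits M)) ]
    ((- 1ℚ) ^ k *
    (∑[ S ∈ sublistsOfSize k (circuits M ∖ C) ]
    _/_ (+ ∣ C ∣) ∣ ⋃ S ∪ C ∣ {{∪-circuit-nonZero M isC (⋃ S)}})))
theorem1 n M C isC = begin
  + length (filter (wins? M C) (orders n)) / length (orders n)
    ≡⟨ /-*-ι (length (filter (wins? M C) (orders n))) (length (orders n)) ⟩
  ι (length (filter (wins? M C) (orders n))) * r
    ≡⟨ cong (_* r) (ι-filter (wins? M C) (orders n)) ⟩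
  (∑[ σ ∈ orders n ] 𝟙 (wins? M C σ)) * r
    ≡⟨ cong (_* r) (∑-cong (orders n) (𝟙-wins M isC)) ⟩
  (∑[ σ ∈ orders n ] ∑[ S ∈ 𝒮 ] (- 1ℚ) ^ length S * 𝟙 (endsIn? (⋃ S ∪ C) C σ)) * r
    -- With `S` outside, each inner sum counts the orders in which `⋃ S ∪ C` ends in `C`.
    ≡⟨ cong (_* r) (∑-swap (λ σ S → (- 1ℚ) ^ length S * 𝟙 (endsIn? (⋃ S ∪ C) C σ)) (orders n) 𝒮) ⟩
  (∑[ S ∈ 𝒮 ] ∑[ σ ∈ orders n ] (- 1ℚ) ^ length S * 𝟙 (endsIn? (⋃ S ∪ C) C σ)) * r
    ≡⟨ ∑-*ʳ r (λ S → ∑[ σ ∈ orders n ] (- 1ℚ) ^ length S * 𝟙 (endsIn? (⋃ S ∪ C) C σ)) 𝒮 ⟨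
  (∑[ S ∈ 𝒮 ] (∑[ σ ∈ orders n ] (- 1ℚ) ^ length S * 𝟙 (endsIn? (⋃ S ∪ C) C σ)) * r)
    ≡⟨ ∑-cong 𝒮 (λ {S} _ → summand S) ⟩
  (∑[ S ∈ 𝒮 ] (- 1ℚ) ^ length S * share S)
    ≡⟨ ∑-bySize ((- 1ℚ) ^_) share (circuits M ∖ C) fewer ⟨
  (∑[ k ∈ upTo (length (circuits M)) ] (- 1ℚ) ^ k * ∑ (sublistsOfSize k (circuits M ∖ C)) share) ∎
  where
  open ≡-Reasoning
  instance
    orders≢0 : NonZero (length (orders n))
    orders≢0 = orders-nonZero n

  r = + 1 / length (orders n)
  𝒮 = sublists (circuits M ∖ C)

  share : List (Subset n) → ℚ
  share S = _/_ (+ ∣ C ∣) ∣ ⋃ S ∪ C ∣ {{∪-circuit-nonZero M isC (⋃ S)}}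

  summand : ∀ S → (∑[ σ ∈ orders n ] (- 1ℚ) ^ length S * 𝟙 (endsIn? (⋃ S ∪ C) C σ)) * r ≡
                  (- 1ℚ) ^ length S * share S
  summand S = begin
    (∑[ σ ∈ orders n ] (- 1ℚ) ^ length S * 𝟙 (endsIn? (⋃ S ∪ C) C σ)) * r
      ≡⟨ cong (_* r) (∑-*ˡ ((- 1ℚ) ^ length S) (λ σ → 𝟙 (endsIn? (⋃ S ∪ C) C σ)) (orders n)) ⟩
    (- 1ℚ) ^ length S * #EndsIn (⋃ S ∪ C) C * r
      ≡⟨ *-assoc ((- 1ℚ) ^ length S) (#EndsIn (⋃ S ∪ C) C) r ⟩
    (- 1ℚ) ^ length S * (#EndsIn (⋃ S ∪ C) C * r)
      ≡⟨ cong ((- 1ℚ) ^ length S *_) (Pr-EndsIn {{orders≢0}} {{∪-circuit-nonZero M isC (⋃ S)}}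
           (C⊆U (proj₂ (circuit-nonempty M isC))) C⊆U) ⟩
    (- 1ℚ) ^ length S * share S ∎
    where
    C⊆U : C ⊆ ⋃ S ∪ C
    C⊆U = Subset.q⊆p∪q (⋃ S) C

  -- Removing the circuit `C` strictly shortens the list, so the sizes `k` below the number of
  -- circuits cover every `S`.
  fewer : length (circuits M ∖ C) ℕ.< length (circuits M)
  fewer = List.filter-notAll (λ D → ¬? (D ≟ˢ C)) (circuits M)
    (Any.map (λ { refl D≢C → D≢C refl }) (from (∈-circuits M) isC))
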